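{- An episturmian word $\mathbf t$ over a finite alphabet $\mathcal A$ is quasiperiodic if and only if the normalized directive word of $\mathbf t$ takes the form \[ \breve w\, a\, v_1\, \bar a\, v_2\, \bar a \cdots v_k\, \bar a\, v\, \breve{\mathbf y} \] for some letter $a\in\mathcal A$ (spin $L$), spinned finite word $\breve w$, $a$-free words $v, v_1,\dots,v_k\in\mathcal A^*$ (spin $L$, $k\ge0$), and a spinned version $\breve{\mathbf y}$ of an infinite word $\mathbf y\in\mathcal A^\omega$ such that $\mathrm{Alph}(av)=\mathrm{Alph}(av\mathbf y)$.
   Context: $\mathrm{Alph}(u)$ is the set of letters of $u$. For $a\in\mathcal{A}$, $L_a,R_a$ are the morphisms with $L_a(a)=R_a(a)=a$, $L_a(b)=ab$, $R_a(b)=ba$ ($b\ne a$). Spinned words are words over $\mathcal A\cup\bar{\mathcal A}$, $\bar{\mathcal A}=\{\bar x:x\in\mathcal A\}$ (letters of $\mathcal A$ have spin $L$, of $\bar{\mathcal A}$ spin $R$); a spinned version of a word over $\mathcal A$ is obtained by possibly barring some of its letters; for $u\in\mathcal A^*$, $\bar u$ is $u$ with all letters barred. $\mu_a=L_a$, $\mu_{\bar a}=R_a$, $\mu_{\breve x_1\cdots\breve x_n}=\mu_{\breve x_1}\circ\cdots\circ\mu_{\breve x_n}$. An infinite word is episturmian if its set of factors is closed under reversal and it has at most one right special factor of each length. A spinned infinite word $\breve x_1\breve x_2\cdots$ directs $\mathbf t$ if there are recurrent infinite words $\mathbf t^{(n)}$ with $\mathbf t^{(0)}=\mathbf t$ and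 $\mathbf t^{(n-1)}=\mu_{\breve x_n}(\mathbf t^{(n)})$ for $n\ge1$. A normalized directive word of $\mathbf t$ is a directive word of $\mathbf t$ containing infinitely many $L$-spinned letters and no factor in $\bigcup_{a\in\mathcal A}\bar a\bar{\mathcal A}^*a$; every episturmian word has one, and it is unique when $\mathbf t$ is aperiodic. A finite word $u$ is a quasiperiod of an infinite word $\mathbf w$ if there are words $p_n$ ($n\ge0$) with $p_0=\varepsilon$, $|p_n|<|p_{n+1}|\le|p_nu|$, $p_nu$ a prefix of $\mathbf w$; $\mathbf w$ is quasiperiodic if it has a quasiperiod. -}

module Defs where

open import Data.Nat using (ℕ; zero; suc; _+_; _≤_; _<_)
open import Data.Fin using (Fin; _≟_)
open import Data.List using (List; []; _∷_; _++_; length; reverse; concatMap; concat; map; take)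
open import Data.List.Membership.Propositional using (_∈_)
open import Data.Product using (Σ; ∃; ∃-syntax; _×_; _,_; proj₁; proj₂)
open import Data.Sum using (_⊎_)
open import Relation.Binary.PropositionalEquality using (_≡_; _≢_)
open import Relation.Nullary using (¬_; yes; no)
open import Function.Bundles using (_⇔_)

Letter : ℕ → Set
Letter n = Fin n

Word : ℕ → Set
Word n = List (Letter n)

InfWord : Set → Set
InfWord X = ℕ → X

pref : {X : Set} → ℕ → InfWord X → List X
pref zero    s = []
pref (suc k) s = s 0 ∷ pref k (λ i → s (suc i))

shift : {X : Set} → ℕ → InfWord X → InfWord X
shift i s j = s (i + j)

IsPrefix : {X : Set} → List X → InfWord X → Set
IsPrefix u s = pref (length u) s ≡ u

OccursAt : {X : Set} → List X → InfWord X → ℕ → Set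
OccursAt u s i = IsPrefix u (shift i s)

Factor : {X : Set} → List X → InfWord X → Set
Factor u s = ∃[ i ] OccursAt u s i

_⋯_ : {X : Set} → List X → InfWord X → InfWord X
([] ⋯ s) i = s i
((x ∷ u) ⋯ s) zero = x
((x ∷ u) ⋯ s) (suc i) = (u ⋯ s) i

Recurrent : {X : Set} → InfWord X → Set
Recurrent s = ∀ u → Factor u s → ∀ m → ∃[ i ] (m ≤ i × OccursAt u s i)

RightSpecial : {n : ℕ} → Word n → InfWord (Letter n) → Set
RightSpecial {n} u t =
  Σ (Letter n) λ a → Σ (Letter n) λ b →
    a ≢ b × Factor (u ++ (a ∷ [])) t × Factor (u ++ (b ∷ [])) t

ClosedUnderReversal : {n : ℕ} → InfWord (Letter n) → Set
ClosedUnderReversal {n} t = ∀ (u : Word n) → Factor u t → Factor (reverse u) t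

AtMostOneRightSpecialPerLength : {n : ℕ} → InfWord (Letter n) → Set
AtMostOneRightSpecialPerLength {n} t =
  ∀ (u v : Word n) → length u ≡ length v →
    RightSpecial u t → RightSpecial v t → u ≡ v

Episturmian : {n : ℕ} → InfWord (Letter n) → Set
Episturmian t = ClosedUnderReversal t × AtMostOneRightSpecialPerLength t

data Spin : Set where
  L R : Spin

-- a spinned letter (a , L) stands for a, (a , R) for ā
SLetter : ℕ → Set
SLetter n = Letter n × Spin

letterOf : {n : ℕ} → SLetter n → Letter n
letterOf = proj₁

spinOf : {n : ℕ} → SLetter n → Spin
spinOf = proj₂

asL : {n : ℕ} → Word n → List (SLetter n)
asL = map (λ b → b , L)

μ₁ : {n : ℕ} → SLetter n → Letter n → Word n
μ₁ (a , s) b with b ≟ a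
... | yes _ = a ∷ []
μ₁ (a , L) b | no _ = a ∷ b ∷ []
μ₁ (a , R) b | no _ = b ∷ a ∷ []

μ : {n : ℕ} → SLetter n → Word n → Word n
μ x = concatMap (μ₁ x)

-- s = μ_x(t) for infinite words t, s
-- (s is the unique infinite word having μ_x(p) as prefix for every prefix p of t)
IsImage : {n : ℕ} → SLetter n → InfWord (Letter n) → InfWord (Letter n) → Set
IsImage x t s = ∀ k → IsPrefix (μ x (pref k t)) s

-- Δ = x₁x₂⋯ (indexed from 0 here: Δ 0 = x₁) directs t
Directs : {n : ℕ} → InfWord (SLetter n) → InfWord (Letter n) → Set
Directs {n} Δ t =
  Σ (ℕ → InfWord (Letter n)) λ T →
    (∀ i → T 0 i ≡ t i) ×
    (∀ k → Recurrent (T k)) ×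
    (∀ k → IsImage (Δ k) (T (suc k)) (T k))

InfinitelyManyL : {n : ℕ} → InfWord (SLetter n) → Set
InfinitelyManyL Δ = ∀ m → ∃[ i ] (m ≤ i × spinOf (Δ i) ≡ L)

HasBarredFactor : {n : ℕ} → InfWord (SLetter n) → Set
HasBarredFactor {n} Δ =
  Σ (Letter n) λ a → Σ ℕ λ i → Σ ℕ λ j →
    i < j × Δ i ≡ (a , R) × Δ j ≡ (a , L) ×
    (∀ k → i < k → k < j → spinOf (Δ k) ≡ R)

NormalizedDirective : {n : ℕ} → InfWord (SLetter n) → InfWord (Letter n) → Set
NormalizedDirective Δ t = Directs Δ t × InfinitelyManyL Δ × ¬ HasBarredFactor Δ

Quasiperiod : {n : ℕ} → Word n → InfWord (Letter n) → Set
Quasiperiod {n} u w =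
  Σ (ℕ → Word n) λ p →
    p 0 ≡ [] ×
    (∀ k → length (p k) < length (p (suc k))) ×
    (∀ k → length (p (suc k)) ≤ length (p k) + length u) ×
    (∀ k → IsPrefix (p k ++ u) w)

Quasiperiodic : {n : ℕ} → InfWord (Letter n) → Set
Quasiperiodic {n} w = Σ (Word n) λ u → Quasiperiod u w

AFree : {n : ℕ} → Letter n → Word n → Set
AFree a v = ¬ (a ∈ v)

InAlphInf : {n : ℕ} → Letter n → Word n → InfWord (Letter n) → Set
InAlphInf c u y = c ∈ u ⊎ ∃[ i ] y i ≡ c

shapePrefix : {n : ℕ} → List (SLetter n) → Letter n → List (Word n) → Word n → List (SLetter n)
shapePrefix w a vs v =
  w ++ ((a , L) ∷ (concat (map (λ vi → asL vi ++ ((a , R) ∷ [])) vs) ++ asL v))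

HasQPShape : {n : ℕ} → InfWord (SLetter n) → Set
HasQPShape {n} Δ =
  Σ (List (SLetter n)) λ w → Σ (Letter n) λ a → Σ (List (Word n)) λ vs →
  Σ (Word n) λ v → Σ (InfWord (SLetter n)) λ y →
    (∀ vi → vi ∈ vs → AFree a vi) ×
    AFree a v ×
    (∀ c → (c ∈ (a ∷ v)) ⇔ InAlphInf c (a ∷ v) (λ i → letterOf (y i))) ×
    (∀ i → Δ i ≡ (shapePrefix w a vs v ⋯ y) i)

{-# OPTIONS --safe #-}
module Submission where

-- A quasiperiod u is a prefix of t, so it is recorded by its length m, and quasiperiodicity
-- says that every position is covered by an occurrence of u.  This is transported along
-- t = μ_x(s) in a relaxed form that allows uncovered letters from a set G.
--
-- If s is covered by u up to isolated letters of G, then L_b(s) is covered by L_b(u)b up to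
-- isolated letters of G ∖ {b}, and R_a(s) by R_a(u) up to G provided that G ⊆ {a}.  Starting
-- from u = ε and G = Alph(av), the shape of Δ brings G down to {a} and then to ∅.
--
-- Conversely, if L_b(s) is covered by u ≠ ε up to powers of letters of G, then s is covered by
-- a strictly shorter word up to powers of letters of G ∪ {b}.  Normalization means that
-- R_a(s) does not begin with a; an uncovered c ≠ a would be followed by a, which cannot start
-- the next occurrence of u, so for R_a the set G becomes G ∩ {a}.  When u has shrunk to ε,
-- G contains all the remaining letters, and the history of G yields the shape.

open import Defs
open import Data.Nat using (ℕ; zero; suc; _+_; _≤_; _<_; z≤n; s≤s; s≤s⁻¹; _<?_)
open import Data.Nat.Properties hiding (_≟_)
open import Data.Fin using (_≟_)
open import Data.List using (List; []; _∷_; _++_; length; concat; map; concatMap)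
open import Data.List.Properties using (∷-injective; ++-assoc; ++-identityʳ; length-++; map-++; concatMap-++)
open import Data.List.Membership.Propositional using (_∈_)
open import Data.List.Membership.Propositional.Properties using (∈-++⁺ˡ; ∈-++⁺ʳ; ∈-++⁻)
open import Data.List.Membership.DecPropositional using (_∈?_)
open import Data.List.Relation.Unary.Any using (here; there)
open import Data.Product using (∃-syntax; _×_; _,_; proj₁; proj₂)
open import Data.Sum using (_⊎_; inj₁; inj₂; [_,_]′)
open import Data.Empty using (⊥; ⊥-elim)
open import Function.Base using (_∘_; id)
open import Function.Bundles using (_⇔_; mk⇔; Equivalence)
open import Relation.Binary.PropositionalEquality using (_≡_; _≢_; refl; sym; trans; cong; subst; module ≡-Reasoning)
open import Relation.Nullary using (¬_; yes; no; contradiction)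

-- Prefixes of infinite words

pref-snoc : {X : Set} (k : ℕ) (s : InfWord X) → pref (suc k) s ≡ pref k s ++ (s k ∷ [])
pref-snoc zero    s = refl
pref-snoc (suc k) s = cong (s 0 ∷_) (pref-snoc k (λ i → s (suc i)))

pref-⋯-shift : {X : Set} (k : ℕ) (s : InfWord X) (i : ℕ) → s i ≡ (pref k s ⋯ shift k s) i
pref-⋯-shift zero    s i       = refl
pref-⋯-shift (suc k) s zero    = refl
pref-⋯-shift (suc k) s (suc i) = pref-⋯-shift k (λ i → s (suc i)) i

IsPrefix-++⁻ʳ : {X : Set} (u v : List X) (s : InfWord X) → IsPrefix (u ++ v) s → OccursAt v s (length u)
IsPrefix-++⁻ʳ []      v s eq = eq
IsPrefix-++⁻ʳ (x ∷ u) v s eq = IsPrefix-++⁻ʳ u v (λ i → s (suc i)) (proj₂ (∷-injective eq))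

pref-cong : {X : Set} (k : ℕ) {s t : InfWord X} → (∀ i → i < k → s i ≡ t i) → pref k s ≡ pref k t
pref-cong zero    eq = refl
pref-cong (suc k) {s} {t} eq
  rewrite eq 0 (s≤s z≤n) | pref-cong k {λ i → s (suc i)} {λ i → t (suc i)} (λ i i<k → eq (suc i) (s≤s i<k)) = refl

pref-injective : {X : Set} (k : ℕ) {s t : InfWord X} → pref k s ≡ pref k t → ∀ i → i < k → s i ≡ t i
pref-injective (suc k) eq zero    _         = proj₁ (∷-injective eq)
pref-injective (suc k) eq (suc i) (s≤s i<k) = pref-injective k (proj₂ (∷-injective eq)) i i<k

length-pref : {X : Set} (k : ℕ) (s : InfWord X) → length (pref k s) ≡ k
length-pref zero    s = refl
length-pref (suc k) s = cong suc (length-pref k (λ i → s (suc i)))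

pref-++ : {X : Set} (k m : ℕ) (s : InfWord X) → pref (k + m) s ≡ pref k s ++ pref m (shift k s)
pref-++ zero    m s = refl
pref-++ (suc k) m s = cong (s 0 ∷_) (pref-++ k m (λ i → s (suc i)))

-- Occurrences of a prefix, given by its length m

Occ : {X : Set} → ℕ → InfWord X → ℕ → Set
Occ m t p = ∀ i → i < m → t (p + i) ≡ t i

Covered : {X : Set} → ℕ → InfWord X → ℕ → Set
Covered m t i = ∃[ p ] (p ≤ i × i < p + m × Occ m t p)

-- The non-strict bound also admits the letter just after an occurrence. Under `L_b` the head `b` of
-- its block lengthens the occurrence, so touched letters get covered heads.
Touched : {X : Set} → ℕ → InfWord X → ℕ → Set
Touched m t i = ∃[ p ] (p ≤ i × i ≤ p + m × Occ m t p)

covered⇒touched : {X : Set} {m : ℕ} {t : InfWord X} {i : ℕ} → Covered m t i → Touched m t i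
covered⇒touched (p , p≤i , i<p+m , occ) = p , p≤i , <⇒≤ i<p+m , occ

covered⇒touched-suc : {X : Set} {m : ℕ} {t : InfWord X} {i : ℕ} → Covered m t i → Touched m t (suc i)
covered⇒touched-suc (p , p≤i , i<p+m , occ) = p , m≤n⇒m≤1+n p≤i , i<p+m , occ

covered-by : ∀ {n} {t : InfWord (Letter n)} → ((u , _) : Quasiperiodic t) → ∀ i → Covered (length u) t i
covered-by {n} {t} (u , p , p0 , p-inc , p-gap , p-pre) = cover
  where
  m = length u

  u-at : ∀ k → pref m (shift (length (p k)) t) ≡ u
  u-at k = IsPrefix-++⁻ʳ (p k) u t (p-pre k)

  -- Since `p 0` is empty, `u` is a prefix of `t`, so each copy of `u` can be compared with the
  -- beginning of `t`.
  occ : ∀ k → Occ m t (length (p k))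
  occ k = pref-injective m (trans (u-at k) (sym (subst (λ l → pref m (shift (length l) t) ≡ u) p0 (u-at 0))))

  locate : ∀ i → ∃[ k ] (length (p k) ≤ i × i < length (p (suc k)))
  locate zero = 0 , subst (λ l → length l ≤ 0) (sym p0) z≤n , ≤-<-trans z≤n (p-inc 0)
  locate (suc i) with locate i
  ... | k , lo , hi with suc i <? length (p (suc k))
  ...   | yes lt = k , m≤n⇒m≤1+n lo , lt
  ...   | no ≮   = suc k , ≮⇒≥ ≮ , ≤-<-trans hi (p-inc (suc k))

  cover : ∀ i → Covered m t i
  cover i with locate i
  ... | k , lo , hi = length (p k) , lo , <-≤-trans hi (p-gap k) , occ k

-- The next occurrence is one that covers the position just after the current one. Hence it starts
-- strictly later and leaves no gap.
quasiperiodic-if-covered : ∀ {n} {t : InfWord (Letter n)} (m : ℕ) → (∀ i → Covered m t i) → Quasiperiodic t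
quasiperiodic-if-covered {n} {t} m cov =
  pref m t , (λ k → pref (proj₁ (pos k)) t) , refl , inc , gap , pre
  where
  pos : ℕ → ∃[ p ] Occ m t p
  pos zero = 0 , λ _ _ → refl
  pos (suc k) with cov (proj₁ (pos k) + m)
  ... | p , _ , _ , occ = p , occ

  inc : ∀ k → length (pref (proj₁ (pos k)) t) < length (pref (proj₁ (pos (suc k))) t)
  inc k rewrite length-pref (proj₁ (pos k)) t | length-pref (proj₁ (pos (suc k))) t
    with cov (proj₁ (pos k) + m)
  ... | p , _ , lt , _ = +-cancelʳ-< m _ p lt

  gap : ∀ k → length (pref (proj₁ (pos (suc k))) t) ≤ length (pref (proj₁ (pos k)) t) + length (pref m t)
  gap k rewrite length-pref (proj₁ (pos k)) t | length-pref (proj₁ (pos (suc k))) t | length-pref m t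
    with cov (proj₁ (pos k) + m)
  ... | p , le , _ , _ = le

  pre : ∀ k → IsPrefix (pref (proj₁ (pos k)) t ++ pref m t) t
  pre k with pos k
  ... | p , occ = begin
    pref (length (pref p t ++ pref m t)) t ≡⟨ cong (λ l → pref l t) (length-++ (pref p t)) ⟩
    pref (length (pref p t) + length (pref m t)) t
      ≡⟨ cong (λ l → pref l t) (trans (cong (_+ length (pref m t)) (length-pref p t)) (cong (p +_) (length-pref m t))) ⟩
    pref (p + m) t ≡⟨ pref-++ p m t ⟩
    pref p t ++ pref m (shift p t) ≡⟨ cong (pref p t ++_) (pref-cong m occ) ⟩
    pref p t ++ pref m t ∎
    where open ≡-Reasoning

-- Block decomposition of μ_x(s)

headLetter innerLetter : ∀ {n} → SLetter n → Letter n → Letter n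
headLetter (a , L) c = a
headLetter (a , R) c = c
innerLetter (a , L) c = c
innerLetter (a , R) c = a

μ₁-same : ∀ {n} (x : SLetter n) {c} → c ≡ letterOf x → μ₁ x c ≡ letterOf x ∷ []
μ₁-same (a , s) {c} eq with c ≟ a
... | yes _  = refl
... | no neq = contradiction eq neq

μ₁-diff : ∀ {n} (x : SLetter n) {c} → c ≢ letterOf x → μ₁ x c ≡ headLetter x c ∷ innerLetter x c ∷ []
μ₁-diff (a , s) {c} neq with c ≟ a
... | yes eq = contradiction eq neq
μ₁-diff (a , L) neq | no _ = refl
μ₁-diff (a , R) neq | no _ = refl

-- Lets `head` treat one-letter and two-letter blocks alike.
headLetter-same : ∀ {n} (x : SLetter n) {c} → c ≡ letterOf x → headLetter x c ≡ letterOf x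
headLetter-same (a , L) eq = refl
headLetter-same (a , R) eq = eq

module Blocks {n} {x : SLetter n} {s t : InfWord (Letter n)} (im : IsImage x s t) where

  -- The position in `t` at which the block of `s j` begins.
  start : ℕ → ℕ
  start j = length (μ x (pref j s))

  private
    a = letterOf x

    μ-snoc : ∀ j → μ x (pref (suc j) s) ≡ μ x (pref j s) ++ μ₁ x (s j)
    μ-snoc j = begin
      μ x (pref (suc j) s)                ≡⟨ cong (μ x) (pref-snoc j s) ⟩
      μ x (pref j s ++ (s j ∷ []))        ≡⟨ concatMap-++ (μ₁ x) (pref j s) (s j ∷ []) ⟩
      μ x (pref j s) ++ (μ₁ x (s j) ++ []) ≡⟨ cong (μ x (pref j s) ++_) (++-identityʳ (μ₁ x (s j))) ⟩
      μ x (pref j s) ++ μ₁ x (s j)        ∎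
      where open ≡-Reasoning

    start-suc : ∀ j → start (suc j) ≡ start j + length (μ₁ x (s j))
    start-suc j = trans (cong length (μ-snoc j)) (length-++ (μ x (pref j s)))

    block : ∀ j → OccursAt (μ₁ x (s j)) t (start j)
    block j = IsPrefix-++⁻ʳ (μ x (pref j s)) (μ₁ x (s j)) t (subst (λ u → IsPrefix u t) (μ-snoc j) (im (suc j)))

  start-same : ∀ {j} → s j ≡ a → start (suc j) ≡ suc (start j)
  start-same {j} eq = trans (start-suc j) (trans (cong (λ u → start j + length u) (μ₁-same x eq)) (+-comm (start j) 1))

  start-diff : ∀ {j} → s j ≢ a → start (suc j) ≡ suc (suc (start j))
  start-diff {j} neq = trans (start-suc j) (trans (cong (λ u → start j + length u) (μ₁-diff x neq)) (+-comm (start j) 2))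

  head : ∀ j → t (start j) ≡ headLetter x (s j)
  head j with s j ≟ a
  ... | yes eq = trans (cong t (sym (+-identityʳ (start j))))
                   (trans (proj₁ (∷-injective (subst (λ u → OccursAt u t (start j)) (μ₁-same x eq) (block j))))
                          (sym (headLetter-same x eq)))
  ... | no neq = trans (cong t (sym (+-identityʳ (start j))))
                   (proj₁ (∷-injective (subst (λ u → OccursAt u t (start j)) (μ₁-diff x neq) (block j))))

  inner : ∀ j → s j ≢ a → t (suc (start j)) ≡ innerLetter x (s j)
  inner j neq = trans (cong t (+-comm 1 (start j)))
    (proj₁ (∷-injective (proj₂ (∷-injective (subst (λ u → OccursAt u t (start j)) (μ₁-diff x neq) (block j))))))

  start-< : ∀ j → start j < start (suc j)
  start-< j with s j ≟ a
  ... | yes eq = ≤-reflexive (sym (start-same eq))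
  ... | no neq = ≤-trans (n≤1+n _) (≤-reflexive (sym (start-diff neq)))

  start-mono-≤ : ∀ {i j} → i ≤ j → start i ≤ start j
  start-mono-≤ {i} {zero} z≤n = ≤-refl
  start-mono-≤ {i} {suc j} i≤1+j with m≤n⇒m<n∨m≡n i≤1+j
  ... | inj₁ i<1+j = ≤-trans (start-mono-≤ (s≤s⁻¹ i<1+j)) (<⇒≤ (start-< j))
  ... | inj₂ refl  = ≤-refl

  start-cancel-< : ∀ {i j} → start i < start j → i < j
  start-cancel-< lt = ≰⇒> (λ j≤i → <⇒≱ lt (start-mono-≤ j≤i))

  start-cancel-≤ : ∀ {i j} → start i < start (suc j) → i ≤ j
  start-cancel-≤ lt = s≤s⁻¹ (start-cancel-< lt)

  j≤start : ∀ j → j ≤ start j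
  j≤start zero    = z≤n
  j≤start (suc j) = ≤-<-trans (j≤start j) (start-< j)

  data Position : ℕ → Set where
    atHead  : ∀ j → Position (start j)
    atInner : ∀ j → s j ≢ a → Position (suc (start j))

  locate : ∀ i → Position i
  locate zero = atHead 0
  locate (suc i) with locate i
  ... | atInner j neq = subst Position (start-diff neq) (atHead (suc j))
  ... | atHead j with s j ≟ a
  ...   | yes eq = subst Position (start-same eq) (atHead (suc j))
  ...   | no neq = atInner j neq

  -- Equal letters have blocks of equal length, so along an occurrence the block boundaries are
  -- those of the prefix, shifted by `start q`.
  start-+ : ∀ {m q} → Occ m s q → ∀ j → j ≤ m → start (q + j) ≡ start q + start j
  start-+ {m} {q} occ zero    _ = trans (cong start (+-identityʳ q)) (sym (+-identityʳ (start q)))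
  start-+ {m} {q} occ (suc j) j<m with start-+ {m} {q} occ j (<⇒≤ j<m) | s j ≟ a
  ... | ih | yes eq = begin
    start (q + suc j)       ≡⟨ cong start (+-suc q j) ⟩
    start (suc (q + j))     ≡⟨ start-same (trans (occ j j<m) eq) ⟩
    suc (start (q + j))     ≡⟨ cong suc ih ⟩
    suc (start q + start j) ≡⟨ +-suc (start q) (start j) ⟨
    start q + suc (start j) ≡⟨ cong (start q +_) (start-same eq) ⟨
    start q + start (suc j) ∎
    where open ≡-Reasoning
  ... | ih | no neq = begin
    start (q + suc j)             ≡⟨ cong start (+-suc q j) ⟩
    start (suc (q + j))           ≡⟨ start-diff (λ eq → neq (trans (sym (occ j j<m)) eq)) ⟩
    suc (suc (start (q + j)))     ≡⟨ cong (suc ∘ suc) ih ⟩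
    suc (suc (start q + start j)) ≡⟨ cong suc (+-suc (start q) (start j)) ⟨
    suc (start q + suc (start j)) ≡⟨ +-suc (start q) (suc (start j)) ⟨
    start q + suc (suc (start j)) ≡⟨ cong (start q +_) (start-diff neq) ⟨
    start q + start (suc j)       ∎
    where open ≡-Reasoning

  occ-image : ∀ {m q} → Occ m s q → Occ (start m) t (start q)
  occ-image {m} {q} occ i i<fm with locate i
  ... | atHead j = begin
    t (start q + start j)      ≡⟨ cong t (start-+ {m} {q} occ j (<⇒≤ j<m)) ⟨
    t (start (q + j))          ≡⟨ head (q + j) ⟩
    headLetter x (s (q + j))   ≡⟨ cong (headLetter x) (occ j j<m) ⟩
    headLetter x (s j)         ≡⟨ head j ⟨
    t (start j)                ∎
    where
    open ≡-Reasoning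
    j<m = start-cancel-< i<fm
  ... | atInner j neq = begin
    t (start q + suc (start j)) ≡⟨ cong t (+-suc (start q) (start j)) ⟩
    t (suc (start q + start j)) ≡⟨ cong (t ∘ suc) (start-+ {m} {q} occ j (<⇒≤ j<m)) ⟨
    t (suc (start (q + j)))     ≡⟨ inner (q + j) (λ eq → neq (trans (sym (occ j j<m)) eq)) ⟩
    innerLetter x (s (q + j))   ≡⟨ cong (innerLetter x) (occ j j<m) ⟩
    innerLetter x (s j)         ≡⟨ inner j neq ⟨
    t (suc (start j))           ∎
    where
    open ≡-Reasoning
    j<m = start-cancel-< (<-trans (n<1+n _) i<fm)

  letter-preserved : ∀ j → ∃[ i ] t i ≡ s j
  letter-preserved j with s j ≟ a
  letter-preserved j | yes eq = start j , trans (head j) (trans (headLetter-same x eq) (sym eq))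
  letter-preserved j | no neq = go x refl
    where
    go : ∀ y → x ≡ y → ∃[ i ] t i ≡ s j
    go (_ , L) refl = suc (start j) , inner j neq
    go (_ , R) refl = start j , head j

  letter-occurs : ∃[ i ] t i ≡ a
  letter-occurs with s 0 ≟ a
  ... | yes eq = start 0 , trans (head 0) (headLetter-same x eq)
  ... | no neq = go x refl
    where
    go : ∀ y → x ≡ y → ∃[ i ] t i ≡ a
    go (_ , L) refl = start 0 , head 0
    go (_ , R) refl = suc (start 0) , inner 0 neq

-- Sufficiency

-- Two consecutive occurrences of the prefix of length m are separated by at most one letter, which satisfies P.
record AlmostCover {n} (P : Letter n → Set) (t : InfWord (Letter n)) : Set where
  constructor almostCover
  field
    m       : ℕ
    touched : ∀ i → Touched m t i
    covered : ∀ i → Covered m t i ⊎ P (t i)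

cover-mono : ∀ {n} {P Q : Letter n → Set} {t} → (∀ c → P c → Q c) → AlmostCover P t → AlmostCover Q t
cover-mono {t = t} P⊆Q (almostCover m touch cov) = almostCover m touch λ i → [ inj₁ , inj₂ ∘ P⊆Q (t i) ]′ (cov i)

-- Every block begins with `b`, so each copy of the image of the prefix is followed by `b` and can
-- be lengthened by it. This covers all heads; only inner letters of uncovered blocks remain, and
-- these differ from `b`.
cover-L : ∀ {n} {b : Letter n} {s t P} → IsImage (b , L) s t → AlmostCover P s → AlmostCover (λ c → P c × c ≢ b) t
cover-L {b = b} {s} {t} {P} im (almostCover m touch cov) = almostCover (suc (start m)) touched covered
  where
  open Blocks im

  occ-L : ∀ {q} → Occ m s q → Occ (suc (start m)) t (start q)
  occ-L {q} occ i i<1+fm with m≤n⇒m<n∨m≡n (s≤s⁻¹ i<1+fm)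
  ... | inj₁ i<fm = occ-image {m} {q} occ i i<fm
  ... | inj₂ refl = trans (cong t (sym (start-+ {m} {q} occ m ≤-refl))) (trans (head (q + m)) (sym (head m)))

  covered-head : ∀ j → Covered (suc (start m)) t (start j)
  covered-head j with touch j
  ... | q , q≤j , j≤q+m , occ = start q , start-mono-≤ q≤j ,
    ≤-trans (s≤s (≤-trans (start-mono-≤ j≤q+m) (≤-reflexive (start-+ {m} {q} occ m ≤-refl))))
            (≤-reflexive (sym (+-suc (start q) (start m)))) , occ-L occ

  touched : ∀ i → Touched (suc (start m)) t i
  touched i with locate i
  ... | atHead j    = covered⇒touched (covered-head j)
  ... | atInner j _ = covered⇒touched-suc (covered-head j)

  covered : ∀ i → Covered (suc (start m)) t i ⊎ (P (t i) × t i ≢ b)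
  covered i with locate i
  ... | atHead j = inj₁ (covered-head j)
  ... | atInner j neq with cov j
  ...   | inj₂ Psj = inj₂ (subst (λ c → P c × c ≢ b) (sym (inner j neq)) (Psj , neq))
  ...   | inj₁ (q , q≤j , j<q+m , occ) = inj₁ (start q , m≤n⇒m≤1+n (start-mono-≤ q≤j) ,
            ≤-trans (s≤s (≤-trans (start-< j) (≤-trans (start-mono-≤ j<q+m) (≤-reflexive (start-+ {m} {q} occ m ≤-refl)))))
                    (≤-reflexive (sym (+-suc (start q) (start m)))) , occ-L occ)

-- An uncovered letter of `s` is `a`, whose block is the single letter `a`. Blocks of length two
-- therefore come from covered letters and are covered entirely.
cover-R : ∀ {n} {a : Letter n} {s t P} → IsImage (a , R) s t → (∀ c → P c → c ≡ a) → AlmostCover P s → AlmostCover P t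
cover-R {a = a} {s} {t} {P} im P⊆a (almostCover m touch cov) = almostCover (start m) touched covered
  where
  open Blocks im

  covered-block : ∀ j i → start j ≤ i → i < start (suc j) → Covered m s j → Covered (start m) t i
  covered-block j i lo hi (q , q≤j , j<q+m , occ) = start q , ≤-trans (start-mono-≤ q≤j) lo ,
    <-≤-trans hi (≤-trans (start-mono-≤ j<q+m) (≤-reflexive (start-+ {m} {q} occ m ≤-refl))) , occ-image {m} {q} occ

  covered-inner : ∀ j → s j ≢ a → Covered (start m) t (suc (start j))
  covered-inner j neq with cov j
  ... | inj₂ Psj = contradiction (P⊆a (s j) Psj) neq
  ... | inj₁ c   = covered-block j _ (n≤1+n _) (≤-reflexive (sym (start-diff neq))) c

  touched : ∀ i → Touched (start m) t i
  touched i with locate i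
  ... | atInner j neq = covered⇒touched (covered-inner j neq)
  ... | atHead j with touch j
  ...   | q , q≤j , j≤q+m , occ = start q , start-mono-≤ q≤j ,
            ≤-trans (start-mono-≤ j≤q+m) (≤-reflexive (start-+ {m} {q} occ m ≤-refl)) , occ-image {m} {q} occ

  covered : ∀ i → Covered (start m) t i ⊎ P (t i)
  covered i with locate i
  ... | atInner j neq = inj₁ (covered-inner j neq)
  ... | atHead j with cov j
  ...   | inj₁ c   = inj₁ (covered-block j _ ≤-refl (start-< j) c)
  ...   | inj₂ Psj = inj₂ (subst P (sym (head j)) Psj)

-- `Chain xs s t` stands for t = μ_xs(s).
data Chain {n} : List (SLetter n) → InfWord (Letter n) → InfWord (Letter n) → Set where
  []  : ∀ {s} → Chain [] s s
  _∷_ : ∀ {x xs s r t} → IsImage x r t → Chain xs s r → Chain (x ∷ xs) s t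

chain-split : ∀ {n} (xs : List (SLetter n)) {ys s t} → Chain (xs ++ ys) s t → ∃[ r ] (Chain xs r t × Chain ys s r)
chain-split []       c = _ , [] , c
chain-split (x ∷ xs) (im ∷ c) with chain-split xs c
... | r , c₁ , c₂ = r , im ∷ c₁ , c₂

cover-asL : ∀ {n P} (v : Word n) {s t} → Chain (asL v) s t → AlmostCover P s →
            AlmostCover (λ c → P c × ¬ (c ∈ v)) t
cover-asL []      []       h = cover-mono (λ c Pc → Pc , λ ()) h
cover-asL (b ∷ v) (im ∷ c) h =
  cover-mono (λ { d ((Pd , d∉v) , d≢b) → Pd , λ { (here eq) → d≢b eq ; (there d∈v) → d∉v d∈v } })
             (cover-L im (cover-asL v c h))

-- Each factor is read from the right: spin `R` on `a` tolerates gaps that are single letters `a`,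
-- and the spin-`L` letters before it add no gaps.
cover-returns : ∀ {n} (a : Letter n) (vs : List (Word n)) {s t} →
                Chain (concat (map (λ vi → asL vi ++ ((a , R) ∷ [])) vs)) s t →
                AlmostCover (_≡ a) s → AlmostCover (_≡ a) t
cover-returns a []       []  h = h
cover-returns a (v ∷ vs) c h with chain-split (asL v ++ ((a , R) ∷ [])) c
... | r , c₁ , c₂ with chain-split (asL v) c₁
...   | r′ , c₃ , (im ∷ []) =
  cover-mono (λ _ → proj₁)
    (cover-asL v c₃ (cover-R im (λ _ → id) (cover-returns a vs c₂ h)))

cover-any : ∀ {n} (w : List (SLetter n)) {s t} → Chain w s t →
            AlmostCover (λ _ → ⊥) s → AlmostCover (λ _ → ⊥) t
cover-any []            []       h = h
cover-any ((b , L) ∷ w) (im ∷ c) h = cover-mono (λ _ → proj₁) (cover-L im (cover-any w c h))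
cover-any ((b , R) ∷ w) (im ∷ c) h = cover-R im (λ _ ()) (cover-any w c h)

-- From the innermost morphism outwards: `v` leaves only `a` uncovered, the returns preserve this,
-- the `L`-spinned `a` before them closes the last gaps, and `w` preserves full coverage.
cover-shape : ∀ {n} w (a : Letter n) vs v {s t} → Chain (shapePrefix w a vs v) s t →
              (∀ i → s i ∈ a ∷ v) → AlmostCover (λ _ → ⊥) t
cover-shape w a vs v {s} c s⊆av with chain-split w c
... | r , cw , (im ∷ c₁) with chain-split (concat (map (λ vi → asL vi ++ ((a , R) ∷ [])) vs)) c₁
...   | r′ , cvs , cv = cover-any w cw
  (cover-mono (λ { _ (eq , neq) → neq eq }) (cover-L im (cover-returns a vs cvs
    (cover-mono only-a (cover-asL v cv base)))))
  where
  -- The prefix of length 0 touches every position and covers none.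
  base : AlmostCover (_∈ a ∷ v) s
  base = almostCover 0 (λ i → i , ≤-refl , m≤m+n i 0 , λ _ ()) (λ i → inj₂ (s⊆av i))

  only-a : ∀ c → c ∈ a ∷ v × ¬ (c ∈ v) → c ≡ a
  only-a c (here eq , _)     = eq
  only-a c (there c∈v , c∉v) = contradiction c∈v c∉v

-- Letters of the words `T k` and of the directive word

≤⇒∃+ : ∀ {m n} → m ≤ n → ∃[ d ] n ≡ d + m
≤⇒∃+ m≤n = _ , sym (m∸n+n≡m m≤n)

module Directed {n} {Δ : InfWord (SLetter n)} (T : ℕ → InfWord (Letter n))
                (image : ∀ k → IsImage (Δ k) (T (suc k)) (T k)) where

  chain : ∀ k xs {y} → (∀ i → Δ (k + i) ≡ (xs ⋯ y) i) → Chain xs (T (k + length xs)) (T k)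
  chain k []       eq = subst (λ l → Chain [] (T l) (T k)) (sym (+-identityʳ k)) []
  chain k (x ∷ xs) eq =
    subst (λ y → IsImage y (T (suc k)) (T k)) (trans (cong Δ (sym (+-identityʳ k))) (eq 0)) (image k) ∷
    subst (λ l → Chain xs (T l) (T (suc k))) (sym (+-suc k (length xs)))
      (chain (suc k) xs (λ i → trans (cong Δ (sym (+-suc k i))) (eq (suc i))))

  letters-descend : ∀ d k j → ∃[ i ] T k i ≡ T (d + k) j
  letters-descend zero    k j = j , refl
  letters-descend (suc d) k j with Blocks.letter-preserved (image (d + k)) j
  ... | i , eq with letters-descend d k i
  ...   | i′ , eq′ = i′ , trans eq′ eq

  directive-letter-occurs : ∀ d k → ∃[ i ] T k i ≡ letterOf (Δ (d + k))
  directive-letter-occurs d k with Blocks.letter-occurs (image (d + k))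
  ... | i , eq with letters-descend d k i
  ...   | i′ , eq′ = i′ , trans eq′ eq

  -- A letter never used by Δ is pulled back to earlier positions, strictly earlier at each spin L.
  pull-back : ∀ {c} k j → T k j ≡ c → letterOf (Δ k) ≢ c →
              ∃[ j′ ] (T (suc k) j′ ≡ c × j′ ≤ j × (spinOf (Δ k) ≡ L → j′ < j))
  pull-back {c} k j eq ≢c with Δ k | image k
  ... | b , L | im with Blocks.locate im j
  ...   | Blocks.atHead q = contradiction (trans (sym (Blocks.head im q)) eq) ≢c
  ...   | Blocks.atInner q neq = q , trans (sym (Blocks.inner im q neq)) eq ,
            m≤n⇒m≤1+n (Blocks.j≤start im q) , λ _ → s≤s (Blocks.j≤start im q)
  pull-back {c} k j eq ≢c | b , R | im with Blocks.locate im j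
  ...   | Blocks.atHead q = q , trans (sym (Blocks.head im q)) eq , Blocks.j≤start im q , λ ()
  ...   | Blocks.atInner q neq = contradiction (trans (sym (Blocks.inner im q neq)) eq) ≢c

  pull-back* : ∀ {c} d k j → (∀ i → letterOf (Δ (i + k)) ≢ c) → T k j ≡ c →
               ∃[ j′ ] (T (d + k) j′ ≡ c × j′ ≤ j)
  pull-back* zero    k j ≢c eq = j , eq , ≤-refl
  pull-back* (suc d) k j ≢c eq with pull-back* d k j ≢c eq
  ... | j₁ , eq₁ , le₁ with pull-back (d + k) j₁ eq₁ (≢c d)
  ...   | j₂ , eq₂ , le₂ , _ = j₂ , eq₂ , ≤-trans le₂ le₁

  module _ (infL : InfinitelyManyL Δ) where

    -- Descent on the position, bounded by `N`: pulling the letter back to the next spin `L` does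
    -- not raise its position, and that spin lowers it strictly.
    unused-letter : ∀ {c} N k j → j < N → (∀ i → letterOf (Δ (i + k)) ≢ c) → T k j ≢ c
    unused-letter {c} (suc N) k j j<N ≢c eq with infL k
    ... | l , k≤l , isL with ≤⇒∃+ k≤l
    ...   | d , refl with pull-back* d k j ≢c eq
    ...     | j₁ , eq₁ , le₁ with pull-back (d + k) j₁ eq₁ (≢c d)
    ...       | j₂ , eq₂ , _ , lt =
      unused-letter N (suc (d + k)) j₂ (<-≤-trans (lt isL) (≤-trans le₁ (s≤s⁻¹ j<N)))
        (λ i eq′ → ≢c (i + suc d) (trans (cong (letterOf ∘ Δ) (+-assoc i (suc d) k)) eq′)) eq₂

    -- `R_b` keeps the first letter of a word, and an image under `L_b` starts with `b`. So the
    -- first spin `L` from `k` on decides the first letter of `T k`; `d` bounds the search.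
    first-L : ∀ d k → spinOf (Δ (d + k)) ≡ L →
              ∃[ j ] (k ≤ j × Δ j ≡ (T k 0 , L) × (∀ l → k ≤ l → l < j → spinOf (Δ l) ≡ R))
    first-L d k isL with Δ k in eq | image k
    ... | b , L | im = k , ≤-refl , trans eq (cong (_, L) (sym (Blocks.head im 0))) , λ l k≤l l<k → contradiction k≤l (<⇒≱ l<k)
    first-L zero    k isL | b , R | im = contradiction (trans (sym (cong spinOf eq)) isL) λ ()
    first-L (suc d) k isL | b , R | im with first-L d (suc k) (trans (cong (spinOf ∘ Δ) (+-suc d k)) isL)
    ... | j , k<j , Δj , between = j , <⇒≤ k<j , trans Δj (cong (_, L) (sym (Blocks.head im 0))) , between′
      where
      between′ : ∀ l → k ≤ l → l < j → spinOf (Δ l) ≡ R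
      between′ l k≤l l<j with m≤n⇒m<n∨m≡n k≤l
      ... | inj₁ k<l  = between l k<l l<j
      ... | inj₂ refl = cong spinOf eq

    -- Otherwise the first spin `L` after `k` would carry the letter `a` and complete a forbidden
    -- factor.
    normalized-head : ¬ HasBarredFactor Δ → ∀ {a} k → Δ k ≡ (a , R) → T k 0 ≢ a
    normalized-head nbf {a} k Δk refl with infL k
    ... | l , k≤l , isL with ≤⇒∃+ k≤l
    ...   | d , refl with first-L d k isL
    ...     | j , k≤j , Δj , between =
      nbf (T k 0 , k , j , ≤∧≢⇒< k≤j k≢j , Δk , Δj , λ l k<l → between l (<⇒≤ k<l))
      where
      k≢j : k ≢ j
      k≢j refl = contradiction (trans (sym (cong spinOf Δk)) (cong spinOf Δj)) λ ()

-- Necessity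

-- The uncovered stretches are powers of a letter of G.
PureGaps : ∀ {n} → ℕ → Word n → InfWord (Letter n) → Set
PureGaps m G t = (∀ i → Covered m t i ⊎ t i ∈ G) ×
                 (0 < m → ∀ i → Covered m t i ⊎ Covered m t (suc i) ⊎ t i ≡ t (suc i))

pureGaps-mono : ∀ {n m} {G H : Word n} {t} → (∀ {c} → c ∈ G → c ∈ H) → PureGaps m G t → PureGaps m H t
pureGaps-mono G⊆H (cov , pure) = (λ i → [ inj₁ , inj₂ ∘ G⊆H ]′ (cov i)) , pure

occ-mono : ∀ {X : Set} {m m′ p} {t : InfWord X} → m ≤ m′ → Occ m′ t p → Occ m t p
occ-mono m≤m′ occ i i<m = occ i (<-≤-trans i<m m≤m′)

-- Occurrences of the old prefix decode to occurrences of a shorter prefix of `s`. Inner letters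
-- transfer coverage back to `s`; a letter `b` of `s` has no inner letter and is conceded to the gap
-- set.
pureGaps-L : ∀ {n} {b : Letter n} {s t M G} → IsImage (b , L) s t → PureGaps (suc M) G t →
             ∃[ m ] (m < suc M × PureGaps m (b ∷ G) s)
pureGaps-L {b = b} {s} {t} {M} {G} im (cov , pure) = m , m<1+M , covered , pure′
  where
  open Blocks im

  -- The letter after the head of block `j` is always `s j`: its inner letter or, if `s j` is `b`,
  -- the head of the next block. The one letter beyond `start m` shows this for the last block too.
  decode : ∀ m {q} → Occ (suc (start m)) t (start q) → Occ m s q
  decode (suc m) {q} occ i i<1+m with m≤n⇒m<n∨m≡n (s≤s⁻¹ i<1+m)
  ... | inj₁ i<m  = decode m (occ-mono {p = start q} (s≤s (<⇒≤ (start-< m))) occ) i i<m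
  ... | inj₂ refl = last
    where
    ih : Occ m s q
    ih = decode m (occ-mono {p = start q} (s≤s (<⇒≤ (start-< m))) occ)

    second : t (suc (start (q + m))) ≡ t (suc (start m))
    second = trans (cong t (trans (cong suc (start-+ {m} {q} ih m ≤-refl)) (sym (+-suc (start q) (start m)))))
                   (occ (suc (start m)) (s≤s (start-< m)))

    second-same : ∀ {j} → s j ≡ b → t (suc (start j)) ≡ b
    second-same {j} eq = trans (cong t (sym (start-same eq))) (head (suc j))

    last : s (q + m) ≡ s m
    last with s (q + m) ≟ b | s m ≟ b
    ... | yes e | yes e′ = trans e (sym e′)
    ... | yes e | no ne′ = contradiction (trans (sym (inner m ne′)) (trans (sym second) (second-same e))) ne′
    ... | no ne | yes e′ = contradiction (trans (sym (inner (q + m) ne)) (trans second (second-same e′))) ne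
    ... | no ne | no ne′ = trans (sym (inner (q + m) ne)) (trans second (inner m ne′))

  -- Drops a trailing block head from the prefix of length `suc M`; the rest consists of `m` whole
  -- blocks.
  record Cut (M : ℕ) : Set where
    field
      m     : ℕ
      m<    : m < suc M
      M≤    : M ≤ start m
      occ-s : ∀ {q} → Occ (suc M) t (start q) → Occ m s q

  cut : ∀ M → Cut M
  cut M with locate M
  ... | atHead j = record { m = j ; m< = s≤s (j≤start j) ; M≤ = ≤-refl ; occ-s = decode j }
  ... | atInner j neq = record
    { m = suc j ; m< = s≤s (s≤s (j≤start j)) ; M≤ = ≤-trans (n≤1+n _) (≤-reflexive (sym (start-diff neq)))
    ; occ-s = occ-s }
    where
    -- The prefix now ends with an inner letter. It differs from `b`, so it cannot be mistaken for
    -- the head of a next block, and no further letter is required.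
    occ-s : ∀ {q} → Occ (suc (suc (start j))) t (start q) → Occ (suc j) s q
    occ-s {q} occ i i<1+j with m≤n⇒m<n∨m≡n (s≤s⁻¹ i<1+j)
    ... | inj₁ i<j  = decode j (occ-mono {p = start q} (n≤1+n _) occ) i i<j
    ... | inj₂ refl = last
      where
      second : t (suc (start (q + j))) ≡ s j
      second = trans (cong t (trans (cong suc (start-+ {j} {q} (decode j (occ-mono {p = start q} (n≤1+n _) occ)) j ≤-refl))
                                    (sym (+-suc (start q) (start j)))))
                     (trans (occ (suc (start j)) ≤-refl) (inner j neq))

      last : s (q + j) ≡ s j
      last with s (q + j) ≟ b
      ... | yes e = contradiction (trans (sym second) (trans (cong t (sym (start-same e))) (head (suc (q + j))))) neq
      ... | no ne = trans (sym (inner (q + j) ne)) second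

  open Cut (cut M) using (m; M≤; occ-s) renaming (m< to m<1+M)

  -- The old prefix starts with `b` and inner letters differ from `b`, so it occurs at block heads
  -- only. The upper bound is not strict because of the dropped trailing head.
  pull : ∀ {i} → Covered (suc M) t i → ∃[ q ] (start q ≤ i × i ≤ start (q + m) × Occ m s q)
  pull {i} (p , p≤i , i<p+M , occ) with locate p
  ... | atInner q neq = contradiction
          (trans (sym (inner q neq)) (trans (cong t (sym (+-identityʳ (suc (start q))))) (trans (occ 0 (s≤s z≤n)) (head 0)))) neq
  ... | atHead q = q , p≤i ,
          ≤-trans (s≤s⁻¹ (≤-trans i<p+M (≤-reflexive (+-suc (start q) M))))
            (≤-trans (+-monoʳ-≤ (start q) M≤) (≤-reflexive (sym (start-+ {m} {q} (occ-s occ) m ≤-refl)))) ,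
          occ-s occ

  covered-inner : ∀ j → s j ≢ b → Covered (suc M) t (suc (start j)) → Covered m s j
  covered-inner j neq c with pull c
  ... | q , lo , hi , occ =
    q , start-cancel-≤ (≤-<-trans lo (≤-reflexive (sym (start-diff neq)))) , start-cancel-< hi , occ

  -- The head may be covered only as the trailing `b` of an occurrence, which then covers just the
  -- preceding letter of `s`.
  covered-head : 0 < m → ∀ j → Covered (suc M) t (start (suc j)) → Covered m s j ⊎ Covered m s (suc j)
  covered-head 0<m j c with pull c
  ... | q , lo , hi , occ with m≤n⇒m<n∨m≡n (start-cancel-≤ (≤-<-trans lo (start-< (suc j))))
  ...   | inj₁ q<1+j = inj₁ (q , s≤s⁻¹ q<1+j , start-cancel-< (<-≤-trans (start-< j) hi) , occ)
  ...   | inj₂ refl  = inj₂ (suc j , ≤-refl , m<m+n (suc j) 0<m , occ)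

  covered : ∀ j → Covered m s j ⊎ s j ∈ b ∷ G
  covered j with s j ≟ b
  ... | yes eq = inj₂ (here eq)
  ... | no neq with cov (suc (start j))
  ...   | inj₁ c   = inj₁ (covered-inner j neq c)
  ...   | inj₂ ∈G  = inj₂ (there (subst (_∈ G) (inner j neq) ∈G))

  inject : ∀ {A B C : Set} → A ⊎ B → A ⊎ B ⊎ C
  inject = [ inj₁ , inj₂ ∘ inj₁ ]′

  -- Unless `s j` and `s (suc j)` are both `b`, one of them has an inner letter, adjacent in `t` to
  -- the head `b` of block `suc j`. These two letters differ, so one of them is covered.
  pure′ : 0 < m → ∀ j → Covered m s j ⊎ Covered m s (suc j) ⊎ s j ≡ s (suc j)
  pure′ 0<m j with s j ≟ b
  pure′ 0<m j | no neq with pure (s≤s z≤n) (suc (start j))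
  ... | inj₁ c         = inj₁ (covered-inner j neq c)
  ... | inj₂ (inj₁ c)  = inject (covered-head 0<m j (subst (Covered (suc M) t) (sym (start-diff neq)) c))
  ... | inj₂ (inj₂ eq) = contradiction
          (trans (sym (inner j neq)) (trans eq (trans (cong t (sym (start-diff neq))) (head (suc j))))) neq
  pure′ 0<m j | yes eq with s (suc j) ≟ b
  ... | yes eq′ = inj₂ (inj₂ (trans eq (sym eq′)))
  ... | no neq with pure (s≤s z≤n) (start (suc j))
  ...   | inj₁ c          = inject (covered-head 0<m j c)
  ...   | inj₂ (inj₁ c)   = inj₂ (inj₁ (covered-inner (suc j) neq c))
  ...   | inj₂ (inj₂ eq′) = contradiction (trans (sym (inner (suc j) neq)) (trans (sym eq′) (head (suc j)))) neq

-- The new prefix has one letter for every block that the old one meets, even partly; unlike for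
-- spin `L`, it need not be shorter. Only `a` can stay uncovered, so `H` has to retain no other
-- letter.
pureGaps-R : ∀ {n} {a : Letter n} {s t M G H} → IsImage (a , R) s t → t 0 ≢ a → (a ∈ G → a ∈ H) →
             PureGaps (suc M) G t → ∃[ m ] (m ≤ suc M × PureGaps m H s)
pureGaps-R {a = a} {s} {t} {M} {G} {H} im t0≢a G⊆H (cov , pure) =
  m , m≤1+M , (λ j → [ inj₁ , (λ { (eq , ∈G) → inj₂ (subst (_∈ H) (sym eq) (G⊆H ∈G)) }) ]′ (covered j)) , λ _ → pure′
  where
  open Blocks im

  cut : ∀ M → ∃[ j ] (start j ≤ M × M < start (suc j))
  cut M with locate M
  ... | atHead j      = j , ≤-refl , start-< j
  ... | atInner j neq = j , n≤1+n _ , ≤-reflexive (sym (start-diff neq))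

  m : ℕ
  m = suc (proj₁ (cut M))

  m≤1+M : m ≤ suc M
  m≤1+M = s≤s (≤-trans (j≤start _) (proj₁ (proj₂ (cut M))))

  -- Under `R_a` the head of a block is the letter of `s` itself, so it suffices to reach the head
  -- of the last block.
  decode : ∀ m {q} → Occ (suc (start m)) t (start q) → Occ (suc m) s q
  decode m {q} occ i i<1+m with m≤n⇒m<n∨m≡n (s≤s⁻¹ i<1+m)
  decode (suc m) {q} occ i i<1+m | inj₁ i<m = decode m (occ-mono {p = start q} (s≤s (<⇒≤ (start-< m))) occ) i i<m
  decode m {q} occ i i<1+m | inj₂ refl = begin
    s (q + i)             ≡⟨ head (q + i) ⟨
    t (start (q + i))     ≡⟨ cong t (start-+ {i} {q} (before i occ) i ≤-refl) ⟩
    t (start q + start i) ≡⟨ occ (start i) ≤-refl ⟩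
    t (start i)           ≡⟨ head i ⟩
    s i                   ∎
    where
    open ≡-Reasoning
    before : ∀ i → Occ (suc (start i)) t (start q) → Occ i s q
    before (suc i) occ = decode i (occ-mono {p = start q} (s≤s (<⇒≤ (start-< i))) occ)

  -- Inner letters are `a`, so `t0≢a` forces occurrences to start at block heads.
  pull : ∀ {i} → Covered (suc M) t i → ∃[ q ] (start q ≤ i × i < start (q + m) × Occ m s q)
  pull {i} (p , p≤i , i<p+M , occ) with locate p
  ... | atInner q neq = contradiction
          (trans (sym (occ 0 (s≤s z≤n))) (trans (cong t (+-identityʳ (suc (start q)))) (inner q neq))) t0≢a
  ... | atHead q = q , p≤i ,
          <-≤-trans i<p+M (≤-trans (+-monoʳ-≤ (start q) (proj₂ (proj₂ (cut M))))
            (≤-reflexive (sym (start-+ {m} {q} occ-s m ≤-refl)))) , occ-s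
    where
    occ-s : Occ m s q
    occ-s = decode _ (occ-mono {p = start q} (s≤s (proj₁ (proj₂ (cut M)))) occ)

  covered-block : ∀ j i → start j ≤ i → i < start (suc j) → Covered (suc M) t i → Covered m s j
  covered-block j i lo hi c with pull c
  ... | q , lo′ , hi′ , occ = q , start-cancel-≤ (≤-<-trans lo′ hi) , start-cancel-< (≤-<-trans lo hi′) , occ

  covered : ∀ j → Covered m s j ⊎ (s j ≡ a × a ∈ G)
  covered j with s j ≟ a
  covered j | yes eq with cov (start j)
  ... | inj₁ c  = inj₁ (covered-block j _ ≤-refl (start-< j) c)
  ... | inj₂ ∈G = inj₂ (eq , subst (_∈ G) (trans (head j) eq) ∈G)
  -- The block consists of two different letters, so purity of the gaps puts one of them inside an
  -- occurrence, and the decoded occurrence contains `s j`.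
  covered j | no neq with pure (s≤s z≤n) (start j)
  ... | inj₁ c         = inj₁ (covered-block j _ ≤-refl (start-< j) c)
  ... | inj₂ (inj₁ c)  = inj₁ (covered-block j _ (n≤1+n _) (≤-reflexive (sym (start-diff neq))) c)
  ... | inj₂ (inj₂ eq) = contradiction (trans (sym (head j)) (trans eq (inner j neq))) neq

  pure′ : ∀ j → Covered m s j ⊎ Covered m s (suc j) ⊎ s j ≡ s (suc j)
  pure′ j with covered j | covered (suc j)
  ... | inj₁ c        | _              = inj₁ c
  ... | inj₂ _        | inj₁ c         = inj₂ (inj₁ c)
  ... | inj₂ (eq , _) | inj₂ (eq′ , _) = inj₂ (inj₂ (trans eq (sym eq′)))

-- The form of directive prefixes, extended letter by letter.

-- The index is Alph(av), with [] standing for a prefix of no particular form.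
data Shape {n} (xs : List (SLetter n)) : Word n → Set where
  none  : Shape xs []
  shape : ∀ w a vs v → (∀ vi → vi ∈ vs → AFree a vi) → AFree a v → xs ≡ shapePrefix w a vs v → Shape xs (a ∷ v)

returns : ∀ {n} → Letter n → List (Word n) → List (SLetter n)
returns a vs = concat (map (λ vi → asL vi ++ ((a , R) ∷ [])) vs)

asL-++ : ∀ {n} (u v : Word n) → asL (u ++ v) ≡ asL u ++ asL v
asL-++ = map-++ (λ b → b , L)

shapePrefix-snoc-L : ∀ {n} w (a : Letter n) vs v b →
                     shapePrefix w a vs v ++ ((b , L) ∷ []) ≡ shapePrefix w a vs (v ++ (b ∷ []))
shapePrefix-snoc-L w a vs v b = begin
  (w ++ ((a , L) ∷ (returns a vs ++ asL v))) ++ ((b , L) ∷ [])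
    ≡⟨ ++-assoc w _ _ ⟩
  w ++ ((a , L) ∷ ((returns a vs ++ asL v) ++ ((b , L) ∷ [])))
    ≡⟨ cong (λ r → w ++ ((a , L) ∷ r)) (++-assoc (returns a vs) _ _) ⟩
  w ++ ((a , L) ∷ (returns a vs ++ (asL v ++ asL (b ∷ []))))
    ≡⟨ cong (λ r → w ++ ((a , L) ∷ (returns a vs ++ r))) (asL-++ v (b ∷ [])) ⟨
  shapePrefix w a vs (v ++ (b ∷ [])) ∎
  where open ≡-Reasoning

shapePrefix-snoc-R : ∀ {n} w (a : Letter n) vs v →
                     shapePrefix w a vs v ++ ((a , R) ∷ []) ≡ shapePrefix w a (vs ++ (v ∷ [])) []
shapePrefix-snoc-R {n} w a vs v = begin
  (w ++ ((a , L) ∷ (returns a vs ++ asL v))) ++ ((a , R) ∷ [])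
    ≡⟨ ++-assoc w _ _ ⟩
  w ++ ((a , L) ∷ ((returns a vs ++ asL v) ++ ((a , R) ∷ [])))
    ≡⟨ cong (λ r → w ++ ((a , L) ∷ r)) eq ⟩
  shapePrefix w a (vs ++ (v ∷ [])) [] ∎
  where
  open ≡-Reasoning
  f : Word n → List (SLetter n)
  f vi = asL vi ++ ((a , R) ∷ [])

  eq : (returns a vs ++ asL v) ++ ((a , R) ∷ []) ≡ returns a (vs ++ (v ∷ [])) ++ []
  eq = begin
    (returns a vs ++ asL v) ++ ((a , R) ∷ []) ≡⟨ ++-assoc (returns a vs) _ _ ⟩
    returns a vs ++ f v                       ≡⟨ cong (returns a vs ++_) (++-identityʳ (f v)) ⟨
    concatMap f vs ++ concatMap f (v ∷ [])    ≡⟨ concatMap-++ f vs (v ∷ []) ⟨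
    returns a (vs ++ (v ∷ []))                ≡⟨ ++-identityʳ _ ⟨
    returns a (vs ++ (v ∷ [])) ++ []          ∎

-- Lets a letter `b` of the final run of spin-`L` letters take over the role of `a`; all that
-- precedes it is absorbed into `w`.
shapePrefix-restart : ∀ {n} w (a : Letter n) vs z b v →
                      shapePrefix w a vs (z ++ (b ∷ v)) ≡ shapePrefix (shapePrefix w a vs z) b [] v
shapePrefix-restart w a vs z b v = begin
  w ++ ((a , L) ∷ (returns a vs ++ asL (z ++ (b ∷ v))))
    ≡⟨ cong (λ r → w ++ ((a , L) ∷ (returns a vs ++ r))) (asL-++ z (b ∷ v)) ⟩
  w ++ ((a , L) ∷ (returns a vs ++ (asL z ++ asL (b ∷ v))))
    ≡⟨ cong (λ r → w ++ ((a , L) ∷ r)) (++-assoc (returns a vs) _ _) ⟨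
  w ++ ((a , L) ∷ ((returns a vs ++ asL z) ++ asL (b ∷ v)))
    ≡⟨ ++-assoc w _ _ ⟨
  shapePrefix w a vs z ++ asL (b ∷ v) ∎
  where open ≡-Reasoning

last-occurrence : ∀ {n} {c : Letter n} (u : Word n) → c ∈ u → ∃[ z ] ∃[ v ] (u ≡ z ++ (c ∷ v) × ¬ (c ∈ v))
last-occurrence {c = c} (x ∷ u) c∈xu with _∈?_ _≟_ c u
last-occurrence (x ∷ u) (there c∈u) | no c∉u = contradiction c∈u c∉u
last-occurrence (x ∷ u) (here refl) | no c∉u = [] , u , refl , c∉u
last-occurrence (x ∷ u) _           | yes c∈u with last-occurrence u c∈u
... | z , v , eq , c∉v = x ∷ z , v , cong (x ∷_) eq , c∉v

full-alphabet-suffix : ∀ {n} (x : Letter n) u →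
  ∃[ z ] ∃[ a ] ∃[ v ] (x ∷ u ≡ z ++ (a ∷ v) × ¬ (a ∈ v) × (∀ {c} → c ∈ x ∷ u → c ∈ a ∷ v))
full-alphabet-suffix x u with _∈?_ _≟_ x u
... | no x∉u = [] , x , u , refl , x∉u , id
full-alphabet-suffix x (y ∷ u) | yes x∈u with full-alphabet-suffix y u
... | z , a , v , eq , a∉v , sub =
  x ∷ z , a , v , cong (x ∷_) eq , a∉v , λ { (here refl) → sub x∈u ; (there c∈u) → sub c∈u }

-- A letter other than `a` joins `v`. If `a` itself returns, the run `v` followed by `a` has all
-- letters of `G`, and its suffix from `full-alphabet-suffix` starts a new shape.
shape-snoc-L : ∀ {n} {xs G} (b : Letter n) → Shape xs G →
               ∃[ H ] ((∀ {c} → c ∈ b ∷ G → c ∈ H) × Shape (xs ++ ((b , L) ∷ [])) H)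
shape-snoc-L {xs = xs} b none = b ∷ [] , id , shape xs b [] [] (λ _ ()) (λ ()) refl
shape-snoc-L b (shape w a vs v vs-free v-free refl) with b ≟ a
... | no b≢a = a ∷ (v ++ (b ∷ [])) ,
      (λ { (here refl)         → there (∈-++⁺ʳ v (here refl))
         ; (there (here refl)) → here refl
         ; (there (there c∈v)) → there (∈-++⁺ˡ c∈v) }) ,
      shape w a vs (v ++ (b ∷ [])) vs-free
        (λ a∈vb → [ v-free , (λ { (here a≡b) → b≢a (sym a≡b) }) ]′ (∈-++⁻ v a∈vb))
        (shapePrefix-snoc-L w a vs v b)
... | yes refl with v ++ (b ∷ []) in eq
...   | [] = contradiction (subst (b ∈_) eq (∈-++⁺ʳ v (here refl))) λ ()
...   | x ∷ u with full-alphabet-suffix x u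
...     | z , a′ , v′ , eq′ , a′∉v′ , sub = a′ ∷ v′ ,
          (λ { (here refl)         → sub (subst (_ ∈_) eq (∈-++⁺ʳ v (here refl)))
             ; (there (here refl)) → sub (subst (_ ∈_) eq (∈-++⁺ʳ v (here refl)))
             ; (there (there c∈v)) → sub (subst (_ ∈_) eq (∈-++⁺ˡ c∈v)) }) ,
          shape (shapePrefix w a vs z) a′ [] v′ (λ _ ()) a′∉v′
            (trans (shapePrefix-snoc-L w a vs v b)
              (trans (cong (shapePrefix w a vs) (trans eq eq′)) (shapePrefix-restart w a vs z a′ v′)))

-- If `c` is `a`, then `v` becomes a further return word. If `c` lies in `v`, its last occurrence
-- becomes the new `a` and the rest of `v` the first return word. Otherwise no gap letter survives
-- and the shape is forgotten.
shape-snoc-R : ∀ {n} {xs G} (c : Letter n) → Shape xs G →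
               ∃[ H ] ((c ∈ G → c ∈ H) × Shape (xs ++ ((c , R) ∷ [])) H)
shape-snoc-R c none = [] , id , none
shape-snoc-R c (shape w a vs v vs-free v-free refl) with c ≟ a | _∈?_ _≟_ c v
... | yes refl | _ = c ∷ [] , (λ _ → here refl) ,
      shape w c (vs ++ (v ∷ [])) []
        (λ vi vi∈ → [ vs-free vi , (λ { (here refl) → v-free }) ]′ (∈-++⁻ vs vi∈)) (λ ())
        (shapePrefix-snoc-R w c vs v)
... | no c≢a | no c∉v = [] , (λ { (here c≡a) → contradiction c≡a c≢a ; (there c∈v) → contradiction c∈v c∉v }) , none
... | no _ | yes c∈v with last-occurrence v c∈v
...   | z , v′ , refl , c∉v′ = c ∷ [] , (λ _ → here refl) ,
      shape (shapePrefix w a vs z) c (v′ ∷ []) [] (λ { _ (here refl) → c∉v′ }) (λ ())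
        (trans (cong (_++ ((c , R) ∷ [])) (shapePrefix-restart w a vs z c v′))
               (shapePrefix-snoc-R (shapePrefix w a vs z) c [] v′))

-- Shrinking the quasiperiod along the directive word

module Necessity {n} {Δ : InfWord (SLetter n)} (T : ℕ → InfWord (Letter n))
                 (image : ∀ k → IsImage (Δ k) (T (suc k)) (T k))
                 (infL : InfinitelyManyL Δ) (nbf : ¬ HasBarredFactor Δ) where

  open Directed T image

  Conclusion : Set
  Conclusion = ∃[ k ] ∃[ G ] (Shape (pref k Δ) G × (∀ i → T k i ∈ G))

  -- d is the distance to a later spin L, where the bound M drops.
  run : ∀ M d k {m G} → m ≤ M → spinOf (Δ (d + k)) ≡ L → PureGaps m G (T k) → Shape (pref k Δ) G → Conclusion
  -- The empty prefix covers nothing, so every letter of `T k` lies in `G`.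
  run M d k {zero} {G} _ _ (cov , _) sh =
    k , G , sh , λ i → [ (λ { (p , p≤i , i<p , _) → contradiction p≤i (<⇒≱ (subst (i <_) (+-identityʳ p) i<p)) }) , id ]′ (cov i)
  run M d k {suc m} m≤M isL gaps sh with Δ k in eq | image k
  -- As the bound drops here, the distance may start afresh from any later spin `L`.
  run (suc M) d k {suc m} (s≤s m≤M) isL gaps sh | b , L | im with pureGaps-L im gaps | shape-snoc-L b sh | infL (suc k)
  ...   | m′ , m′< , gaps′ | H , G⊆H , sh′ | l , k<l , isL′ with ≤⇒∃+ k<l
  ...     | d′ , refl = run M d′ (suc k) (≤-trans (s≤s⁻¹ m′<) m≤M) isL′ (pureGaps-mono G⊆H gaps′)
              (subst (λ xs → Shape xs H) (sym (trans (pref-snoc k Δ) (cong (λ y → pref k Δ ++ (y ∷ [])) eq))) sh′)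
  run M zero    k {suc m} m≤M isL gaps sh | b , R | im = contradiction (trans (sym (cong spinOf eq)) isL) λ ()
  run M (suc d) k {suc m} m≤M isL gaps sh | b , R | im with shape-snoc-R b sh
  ... | H , G⊆H , sh′ with pureGaps-R im (normalized-head infL nbf k eq) G⊆H gaps
  ...   | m′ , m′≤ , gaps′ = run M d (suc k) (≤-trans m′≤ m≤M) (trans (cong (spinOf ∘ Δ) (+-suc d k)) isL) gaps′
              (subst (λ xs → Shape xs H) (sym (trans (pref-snoc k Δ) (cong (λ y → pref k Δ ++ (y ∷ [])) eq))) sh′)

  conclude : Conclusion → HasQPShape Δ
  -- The first letter of `T k` would lie in an empty gap set.
  conclude (k , _ , none , T⊆G) = contradiction (T⊆G 0) λ ()
  conclude (k , _ , shape w a vs v vs-free v-free eq , T⊆G) =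
    w , a , vs , v , shift k Δ , vs-free , v-free , (λ c → mk⇔ inj₁ [ id , from-y ]′) ,
    λ i → trans (pref-⋯-shift k Δ i) (cong (λ xs → (xs ⋯ shift k Δ) i) eq)
    where
    -- Letters directing from index `k` on occur in `T k`, whose letters all lie in `a ∷ v`.
    from-y : ∀ {c} → ∃[ i ] letterOf (Δ (k + i)) ≡ c → c ∈ a ∷ v
    from-y (i , refl) with directive-letter-occurs i k
    ... | j , eq′ = subst (_∈ a ∷ v) (trans eq′ (cong (letterOf ∘ Δ) (+-comm i k))) (T⊆G j)

  necessity : ∀ {m} → (∀ i → Covered m (T 0) i) → HasQPShape Δ
  necessity {m} cov with infL 0
  ... | d , _ , isL = conclude (run m d 0 ≤-refl (trans (cong (spinOf ∘ Δ) (+-identityʳ d)) isL)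
                                 ((λ i → inj₁ (cov i)) , λ _ i → inj₁ (cov i)) none)

covered-cong : ∀ {X : Set} {m} {s t : InfWord X} → (∀ i → s i ≡ t i) → ∀ {i} → Covered m s i → Covered m t i
covered-cong s≗t (p , lo , hi , occ) = p , lo , hi , λ i i<m → trans (sym (s≗t _)) (trans (occ i i<m) (s≗t i))

⋯-tail : ∀ {X : Set} (u : List X) (y : InfWord X) i → (u ⋯ y) (length u + i) ≡ y i
⋯-tail []      y i = refl
⋯-tail (x ∷ u) y i = ⋯-tail u y i

theorem4p29 : (n : ℕ) (t : InfWord (Letter n)) → Episturmian t →
    (Δ : InfWord (SLetter n)) → NormalizedDirective Δ t →
    Quasiperiodic t ⇔ HasQPShape Δ
theorem4p29 n t _ Δ ((T , T0 , _ , image) , infL , nbf) = mk⇔ to from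
  where
  open Directed T image

  to : Quasiperiodic t → HasQPShape Δ
  to qp = Necessity.necessity T image infL nbf (λ i → covered-cong (λ j → sym (T0 j)) (covered-by qp i))

  from : HasQPShape Δ → Quasiperiodic t
  from (w , a , vs , v , y , _ , _ , alph , Δ≡)
    with cover-shape w a vs v (chain 0 (shapePrefix w a vs v) Δ≡) letters
    where
    k = length (shapePrefix w a vs v)

    -- By the alphabet condition a letter outside `a ∷ v` never directs from index `k` on, so it
    -- cannot occur in `T k`.
    letters : ∀ i → T k i ∈ a ∷ v
    letters i with _∈?_ _≟_ (T k i) (a ∷ v)
    ... | yes ∈av = ∈av
    ... | no ∉av = ⊥-elim (unused-letter infL (suc i) k i ≤-refl
            (λ j eq → ∉av (Equivalence.from (alph (T k i))
              (inj₂ (j , trans (cong letterOf (sym (trans (cong Δ (+-comm j k))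
                (trans (Δ≡ (k + j)) (⋯-tail (shapePrefix w a vs v) y j))))) eq)))) refl)
  ... | almostCover m _ cov = quasiperiodic-if-covered m λ i → covered-cong T0 ([ id , ⊥-elim ]′ (cov i))
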